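{- Let $q$ be a prime power and $k\ge 1$ an integer. A simple graph $G$ satisfies $\operatorname{mr}(\mathbb{F}_q,G)\le k$ (i.e. $G\in\mathcal{G}_k(\mathbb{F}_q)$) if and only if $G$ is a blowup of some graph of the form $H\cup K_1$ with $H\in\mathfrak{g}_k(\mathbb{F}_q)$, where $K_1$ denotes a single isolated nonlooped vertex and $\cup$ is disjoint union.
   Context: Graphs may have loops but no multiple edges; a simple graph has no loops. For a field $F$ and a simple graph $G$ on vertices $\{1,\dots,n\}$, $S(F,G)$ is the set of symmetric $n\times n$ matrices $A$ over $F$ with $a_{ij}\neq 0$ for $i\ne j$ iff $ij$ is an edge of $G$ (diagonal entries unrestricted); $\operatorname{mr}(F,G)=\min\{\operatorname{rank}A: A\in S(F,G)\}$ and $\mathcal{G}_k(F)=\{G:\operatorname{mr}(F,G)\le k\}$. For a symmetric $n\times n$ matrix $A$, the looped graph corresponding to $A$, $\Gamma(A)$, has vertex set $\{1,\dots,n\}$, an edge $ij$ ($i\neq j$) iff $a_{ij}\neq0$, and a loop at $i$ iff $a_{ii}\ne 0$. Definition of $\mathfrak{g}_k(\mathbb{F}_q)$: let $x_1,\dots,x_m$ be representatives of the classes of nonzero vectors of $\mathbb{F}_q^k$ under the relation $x\sim cx$ ($c\in\mathbb{F}_q$, $c\neq0$), and let $U=[x_1\ \cdots\ x_m]$ be the $k\times m$ matrix with these columns; $\mathfrak{g}_k(\mathbb{F}_q)$ is the set of isomorphism classes of looped graphs $\Gamma(U^tBU)$ as $B$ ranges over the invertible symmetric $k\times k$ matrices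 over $\mathbb{F}_q$ (equivalently over a set of representatives of congruence classes $B\mapsto C^tBC$, $C$ invertible). A blowup of a looped graph $G$ with vertices $v_1,\dots,v_n$ is a simple graph obtained by replacing each nonlooped vertex $v_i$ by a (possibly empty) independent set $V_i$, each looped vertex $v_i$ by a (possibly empty) clique $V_i$, and each edge $v_iv_j$ ($i\ne j$) by all edges $xy$ with $x\in V_i$, $y\in V_j$. -}

module Defs where

open import Algebra.Bundles using (CommutativeRing)
import Algebra.Properties.Semiring.Sum as SemiringSum
open import Data.Bool.Base using (if_then_else_)
open import Data.Empty using (⊥)
open import Data.Fin.Base using (Fin)
import Data.Fin.Properties as Fin
open import Data.Nat.Base using (ℕ; _^_; _≤_)
open import Data.Nat.Primality using (Prime)
open import Data.Product.Base using (∃-syntax; Σ-syntax; _×_)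
open import Data.Sum.Base using (_⊎_)
open import Data.Sum.Relation.Binary.Pointwise using (Pointwise; ⊎-symmetric)
open import Data.Unit.Base using (⊤)
open import Data.Vec.Functional using (Vector; transpose)
open import Function.Base using (_∘_)
open import Function.Bundles using (Inverse; _⇔_; _↔_)
open import Level using (Level; _⊔_; 0ℓ) renaming (suc to lsuc)
open import Relation.Binary.Core using (Rel)
open import Relation.Binary.Definitions using (Symmetric)
open import Relation.Binary.PropositionalEquality.Core using (_≡_; _≢_)
import Relation.Binary.PropositionalEquality.Properties as ≡
import Relation.Binary.Reasoning.Setoid as SetoidReasoning
open import Relation.Nullary.Decidable.Core using (does)
open import Relation.Nullary.Negation.Core using (¬_)

------------------------------------------------------------------------
-- Graphs

-- No decidability of adjacency is demanded.

record LoopedGraph (V : Set) (a : Level) : Set (lsuc a) where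
  field
    Adj     : Rel V a
    adj-sym : Symmetric Adj

  Looped : V → Set a
  Looped v = Adj v v

record SimpleGraph (V : Set) (a : Level) : Set (lsuc a) where
  field
    loopedGraph : LoopedGraph V a

  open LoopedGraph loopedGraph public

  field
    loopless : ∀ v → ¬ Looped v

record _≅_ {V W : Set} {a b : Level}
           (G : LoopedGraph V a) (H : LoopedGraph W b) : Set (a ⊔ b) where
  private
    module G = LoopedGraph G
    module H = LoopedGraph H
  field
    bijection : V ↔ W
  open Inverse bijection public using (to; from)
  field
    adj⇔ : ∀ u v → G.Adj u v ⇔ H.Adj (to u) (to v)

infixr 6 _∪_

_∪_ : ∀ {V W a b} → LoopedGraph V a → LoopedGraph W b → LoopedGraph (V ⊎ W) (a ⊔ b)
G ∪ H = record
  { Adj     = Pointwise G.Adj H.Adj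
  ; adj-sym = ⊎-symmetric G.adj-sym H.adj-sym
  }
  where
  module G = LoopedGraph G
  module H = LoopedGraph H

K₁ : LoopedGraph ⊤ 0ℓ
K₁ = record { Adj = λ _ _ → ⊥ ; adj-sym = λ () }

-- The set replacing the vertex i of H is the (possibly empty) fibre of
-- `part` over i.

record IsBlowup {V W : Set} {a b : Level}
                (G : SimpleGraph V a) (H : LoopedGraph W b) : Set (a ⊔ b) where
  private
    module G = SimpleGraph G
    module H = LoopedGraph H
  field
    part        : V → W
    independent : ∀ {i} → ¬ H.Looped i →
                  ∀ {x y} → part x ≡ i → part y ≡ i → ¬ G.Adj x y
    clique      : ∀ {i} → H.Looped i →
                  ∀ {x y} → part x ≡ i → part y ≡ i → x ≢ y → G.Adj x y
    joined      : ∀ {i j} → i ≢ j → H.Adj i j →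
                  ∀ {x y} → part x ≡ i → part y ≡ j → G.Adj x y
    unjoined    : ∀ {i j} → i ≢ j → ¬ H.Adj i j →
                  ∀ {x y} → part x ≡ i → part y ≡ j → ¬ G.Adj x y

------------------------------------------------------------------------
-- Fields

-- Discrete rather than Heyting: every element not equal to zero is
-- invertible. This is the usual notion for finite fields, where ≈ is
-- decidable.

record Field (c ℓ : Level) : Set (lsuc (c ⊔ ℓ)) where
  field
    commutativeRing : CommutativeRing c ℓ

  open CommutativeRing commutativeRing public

  field
    0≉1     : ¬ (0# ≈ 1#)
    inverse : ∀ x → ¬ (x ≈ 0#) → ∃[ y ] x * y ≈ 1#

HasOrder : ∀ {c ℓ} → Field c ℓ → ℕ → Set (c ⊔ ℓ)
HasOrder F q = Inverse (Field.setoid F) (≡.setoid (Fin q))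

IsPrimePower : ℕ → Set
IsPrimePower q = ∃[ p ] ∃[ e ] Prime p × 1 ≤ e × q ≡ p ^ e

------------------------------------------------------------------------
-- Matrices over a field

module _ {c ℓ} (F : Field c ℓ) where

  open Field F
  open SemiringSum semiring
    using (sum; sum-cong-≋; ∑-comm; *-distribʳ-sum)

  Matrix : ℕ → ℕ → Set c
  Matrix m n = Vector (Vector Carrier n) m

  infixl 7 _⊗_

  _⊗_ : ∀ {l m n} → Matrix l m → Matrix m n → Matrix l n
  (A ⊗ B) i j = sum (λ a → A i a * B a j)

  I : ∀ {n} → Matrix n n
  I i j = if does (i Fin.≟ j) then 1# else 0#

  infix 4 _≈ᴹ_

  _≈ᴹ_ : ∀ {m n} → Rel (Matrix m n) ℓ
  A ≈ᴹ B = ∀ i j → A i j ≈ B i j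

  IsSymmetric : ∀ {n} → Matrix n n → Set ℓ
  IsSymmetric A = transpose A ≈ᴹ A

  IsInvertible : ∀ {n} → Matrix n n → Set (c ⊔ ℓ)
  IsInvertible A = ∃[ C ] A ⊗ C ≈ᴹ I × C ⊗ A ≈ᴹ I

  LinearlyIndependent : ∀ {m r} → Vector (Vector Carrier m) r → Set (c ⊔ ℓ)
  LinearlyIndependent {r = r} v =
    ∀ (s : Vector Carrier r) →
    (∀ i → sum (λ j → s j * v j i) ≈ 0#) → ∀ j → s j ≈ 0#

  -- The rank is the maximum number of linearly independent columns.

  IndependentColumns : ∀ {m n} → Matrix m n → ℕ → Set (c ⊔ ℓ)
  IndependentColumns {n = n} A r =
    Σ[ f ∈ (Fin r → Fin n) ] LinearlyIndependent (transpose A ∘ f)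

  HasRank : ∀ {m n} → Matrix m n → ℕ → Set (c ⊔ ℓ)
  HasRank A r = IndependentColumns A r × (∀ s → IndependentColumns A s → s ≤ r)

  congruence-symmetric : ∀ {k m} (U : Matrix k m) {B : Matrix k k} →
                         IsSymmetric B → IsSymmetric (transpose U ⊗ B ⊗ U)
  congruence-symmetric U {B} B-sym i j = begin
    sum (λ b → sum (λ a → U a j * B a b) * U b i)
      ≈⟨ sum-cong-≋ (λ b → *-distribʳ-sum (U b i) (λ a → U a j * B a b)) ⟩
    sum (λ b → sum (λ a → U a j * B a b * U b i))
      ≈⟨ ∑-comm (λ b a → U a j * B a b * U b i) ⟩
    sum (λ a → sum (λ b → U a j * B a b * U b i))
      ≈⟨ sum-cong-≋ (λ a → sum-cong-≋ (λ b → swap a b)) ⟩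
    sum (λ a → sum (λ b → U b i * B b a * U a j))
      ≈⟨ sum-cong-≋ (λ a → *-distribʳ-sum (U a j) (λ b → U b i * B b a)) ⟨
    sum (λ a → sum (λ b → U b i * B b a) * U a j) ∎
    where
    open SetoidReasoning setoid
    swap : ∀ a b → U a j * B a b * U b i ≈ U b i * B b a * U a j
    swap a b = begin
      U a j * B a b * U b i    ≈⟨ *-comm _ _ ⟩
      U b i * (U a j * B a b)  ≈⟨ *-congˡ (*-comm _ _) ⟩
      U b i * (B a b * U a j)  ≈⟨ *-assoc _ _ _ ⟨
      U b i * B a b * U a j    ≈⟨ *-congʳ (*-congˡ (B-sym b a)) ⟩
      U b i * B b a * U a j    ∎

  ----------------------------------------------------------------------
  -- Minimum rank

  -- S G A says that A belongs to S(F,G).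

  S : ∀ {n g} → SimpleGraph (Fin n) g → Matrix n n → Set (ℓ ⊔ g)
  S G A = IsSymmetric A × (∀ i j → i ≢ j → (A i j ≉ 0#) ⇔ Adj i j)
    where open SimpleGraph G

  -- IsMr G r says that mr(F,G) = r.

  IsMr : ∀ {n g} → SimpleGraph (Fin n) g → ℕ → Set (c ⊔ ℓ ⊔ g)
  IsMr G r =
    (∃[ A ] S G A × HasRank A r) ×
    (∀ A → S G A → ∀ s → HasRank A s → r ≤ s)

  𝒢 : ∀ {n g} → ℕ → SimpleGraph (Fin n) g → Set (c ⊔ ℓ ⊔ g)
  𝒢 k G = ∃[ r ] IsMr G r × r ≤ k

  ----------------------------------------------------------------------
  -- The looped graphs 𝔤ₖ(F)

  Γ : ∀ {n} (A : Matrix n n) → IsSymmetric A → LoopedGraph (Fin n) ℓ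
  Γ A A-sym = record
    { Adj     = λ i j → A i j ≉ 0#
    ; adj-sym = λ {i} {j} Aij≉0 Aji≈0 → Aij≉0 (trans (A-sym j i) Aji≈0)
    }

  IsNonzero : ∀ {k} → Vector Carrier k → Set ℓ
  IsNonzero x = ¬ (∀ i → x i ≈ 0#)

  infix 4 _∼_

  _∼_ : ∀ {k} → Rel (Vector Carrier k) (c ⊔ ℓ)
  x ∼ y = ∃[ t ] t ≉ 0# × (∀ i → y i ≈ t * x i)

  -- The columns of U represent each ∼-class of nonzero vectors exactly once.

  record IsRepresentatives {k m} (U : Matrix k m) : Set (c ⊔ ℓ) where
    private
      column = transpose U
    field
      nonzero  : ∀ j → IsNonzero (column j)
      complete : ∀ x → IsNonzero x → ∃[ j ] column j ∼ x
      distinct : ∀ i j → column i ∼ column j → i ≡ j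

  -- Membership in 𝔤ₖ(F) of the isomorphism class of H. The choice of U is
  -- immaterial: another choice permutes and rescales its columns by nonzero
  -- scalars, which changes Γ (Uᵗ B U) only up to isomorphism.

  record 𝔤 {n h} (k : ℕ) (H : LoopedGraph (Fin n) h) : Set (c ⊔ ℓ ⊔ h) where
    field
      {m}             : ℕ
      U               : Matrix k m
      representatives : IsRepresentatives U
      B               : Matrix k k
      symmetric       : IsSymmetric B
      invertible      : IsInvertible B
      isomorphism     : H ≅ Γ (transpose U ⊗ B ⊗ U) (congruence-symmetric U symmetric)

{-# OPTIONS --safe #-}
module Submission where

-- A symmetric A of rank r is X C Xᵗ with C an invertible principal r × r submatrix, and
-- padding C by an identity block and X by zero columns gives A = X B Xᵗ with B invertible
-- of size k, for any k ≥ r. A row of X is zero or proportional to a unique class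
-- representative u, and rescaling rows does not affect which entries of X B Xᵗ vanish; so
-- the graph of A is a blowup of Γ(Uᵗ B U) ∪ K₁, with K₁ receiving the zero rows.
-- Conversely, put the representative (or 0) of its part in the row of each vertex:
-- X B Xᵗ then has the required pattern and rank at most k. Since F is finite, every
-- existence question (including the minimum defining mr) is decided by exhaustion.

open import Defs
open import Algebra.Properties.CommutativeSemigroup using (interchange)
import Algebra.Properties.Ring as RingProperties
import Algebra.Properties.Semiring.Sum as SemiringSum
open import Data.Fin.Base using (Fin; zero; suc; combine; finToFun; funToFin)
import Data.Fin.Properties as Fin
open import Data.Nat.Base as ℕ using (ℕ; zero; suc; _≤_; _<_; _^_; z≤n; s≤s)
open import Data.Nat.Induction using (<-rec)
import Data.Nat.Properties as ℕ
open import Data.Product.Base using (Σ-syntax; ∃-syntax; ∃; _×_; _,_; proj₁; proj₂)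
open import Data.Sum.Base as Sum using (_⊎_; inj₁; inj₂)
open import Data.Sum.Relation.Binary.Pointwise as Pointwise using (inj₁; inj₂)
import Data.Sum.Properties as Sum
open import Data.Unit.Base using (⊤; tt)
import Data.Unit.Properties as Unit
open import Data.Vec.Functional using (Vector; transpose; head; tail; _∷_)
import Data.Vec.Functional.Relation.Binary.Equality.Setoid as VectorEquality
open import Function.Base using (_∘_; _$_; id)
open import Function.Bundles using (Equivalence; Injection; Inverse; _⇔_; mk⇔)
open import Function.Construct.Identity using (⇔-id; ↔-id)
open import Function.Construct.Composition using (_⇔-∘_)
open import Function.Construct.Symmetry using (⇔-sym)
open import Function.Definitions using (StrictlySurjective)
open import Function.Properties.Inverse using (Inverse⇒Injection)
open import Level using (Level; _⊔_)
open import Relation.Binary.Bundles using (Setoid)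
open import Relation.Binary.Core using (Rel)
open import Relation.Binary.Definitions using (DecidableEquality; Reflexive; Symmetric)
import Relation.Binary.Definitions as Binary
open import Relation.Binary.PropositionalEquality as ≡ using (_≡_; _≢_)
import Relation.Binary.Reasoning.Setoid as SetoidReasoning
open import Relation.Nullary.Decidable as Dec
  using (Dec; yes; no; map′; ¬?; _×-dec_; _→-dec_; decidable-stable; via-injection)
open import Relation.Nullary.Negation using (¬_; contradiction)
open import Relation.Unary using (Decidable)

private
  variable
    a b p r : Level

-- Least and greatest natural numbers

-- Strong induction: a bounded search either finds a smaller witness to recurse on or certifies that
-- `n` is minimal. It supplies the minimum in `IsMr`.
least : {P : ℕ → Set p} → Decidable P → ∀ n → P n →
        ∃[ m ] m ≤ n × P m × (∀ i → P i → m ≤ i)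
least {P = P} P? = <-rec _ step
  where
  step : ∀ n → (∀ {i} → i < n → P i → ∃[ m ] m ≤ i × P m × (∀ j → P j → m ≤ j)) →
         P n → ∃[ m ] m ≤ n × P m × (∀ j → P j → m ≤ j)
  step n rec Pn with ℕ.anyUpTo? P? n
  ... | yes (i , i<n , Pi) =
    let m , m≤i , rest = rec i<n Pi in m , ℕ.≤-trans m≤i (ℕ.<⇒≤ i<n) , rest
  ... | no none = n , ℕ.≤-refl , Pn , λ i Pi → ℕ.≮⇒≥ λ i<n → none (i , i<n , Pi)

-- The bound drops by one for as long as `P` fails at it; `P 0` settles the case where it reaches
-- zero. It supplies the maximum in `HasRank`.
greatest : {P : ℕ → Set p} → Decidable P → P 0 → ∀ n → (∀ i → P i → i ≤ n) →
           ∃[ m ] P m × (∀ i → P i → i ≤ m)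
greatest P? P0 zero    bound = 0 , P0 , bound
greatest P? P0 (suc n) bound with P? (suc n)
... | yes Pn = suc n , Pn , bound
... | no ¬Pn = greatest P? P0 n λ i Pi →
  ℕ.≤-pred (ℕ.≤∧≢⇒< (bound i Pi) λ { ≡.refl → ¬Pn Pi })

-- Finite setoids

funToFin-cong : ∀ {m n} {f g : Fin m → Fin n} → (∀ i → f i ≡ g i) → funToFin f ≡ funToFin g
funToFin-cong {zero}  f≗g = ≡.refl
funToFin-cong {suc m} f≗g = ≡.cong₂ combine (f≗g zero) (funToFin-cong (f≗g ∘ suc))

funToFin-injective : ∀ {m n} {f g : Fin m → Fin n} →
                     funToFin f ≡ funToFin g → ∀ i → f i ≡ g i
funToFin-injective {f = f} {g} eq i = ≡.trans (≡.sym (Fin.finToFun-funToFin f i))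
  (≡.trans (≡.cong (λ x → finToFun x i) eq) (Fin.finToFun-funToFin g i))

finToFun-injective : ∀ {m n} {x y : Fin (n ^ m)} →
                     (∀ i → finToFun {n} {m} x i ≡ finToFun y i) → x ≡ y
finToFun-injective {m} {n} {x} {y} eq = ≡.trans (≡.sym (Fin.funToFin-finToFin {m} {n} x))
  (≡.trans (funToFin-cong eq) (Fin.funToFin-finToFin {m} {n} y))

-- A surjection up to `≈` is enough for exhaustive search, so repetitions are allowed. In this form
-- the notion passes to vectors, and hence to matrices, by way of `finToFun`.
Enumerable : Setoid a b → Set (a ⊔ b)
Enumerable X = ∃[ n ] Σ[ e ∈ (Fin n → Carrier) ] StrictlySurjective _≈_ e
  where open Setoid X

module _ (X : Setoid a b) (enum : Enumerable X) where

  open Setoid X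
  private
    size = proj₁ enum
    e    = proj₁ (proj₂ enum)
    sur  = proj₂ (proj₂ enum)

  -- `P` has to respect `≈` because the enumeration meets each element only up to `≈`.
  exists? : {P : Carrier → Set p} → (∀ {x y} → x ≈ y → P x → P y) →
            Decidable P → Dec (∃ P)
  exists? resp P? = map′ (λ (i , Pe) → e i , Pe)
    (λ (x , Px) → proj₁ (sur x) , resp (sym (proj₂ (sur x))) Px)
    (Fin.any? (P? ∘ e))

  forall? : {P : Carrier → Set p} → (∀ {x y} → x ≈ y → P x → P y) →
            Decidable P → Dec (∀ x → P x)
  forall? resp P? = map′ (λ Pe x → resp (proj₂ (sur x)) (Pe (proj₁ (sur x)))) (_∘ e)
    (Fin.all? (P? ∘ e))

  enumerable-vectors : ∀ n → Enumerable (VectorEquality.≋-setoid X n)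
  enumerable-vectors n = size ^ n , (λ i → e ∘ finToFun i) , λ v →
    funToFin (λ j → proj₁ (sur (v j))) , λ j →
      trans (reflexive (≡.cong e (Fin.finToFun-funToFin (λ j → proj₁ (sur (v j))) j)))
            (proj₂ (sur (v j)))

enumerable-Fin : ∀ n → Enumerable (≡.setoid (Fin n))
enumerable-Fin n = n , id , λ i → i , ≡.refl

-- Greedy choice from the end of the list: an element satisfying `P` is kept unless some kept
-- element is already related to it. A skipped one is covered by the element that blocks it, a kept
-- one by itself.
transversal : {A : Set a} {P : A → Set p} {_∼_ : Rel A r} →
              Decidable P → Binary.Decidable _∼_ → Reflexive _∼_ → Symmetric _∼_ →
              ∀ n (e : Fin n → A) →
              ∃[ m ] Σ[ u ∈ (Fin m → A) ]
                (∀ j → P (u j)) ×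
                (∀ i → P (e i) → ∃[ j ] u j ∼ e i) ×
                (∀ i j → u i ∼ u j → i ≡ j)
transversal P? _∼?_ ∼-refl ∼-sym zero    e = 0 , (λ ()) , (λ ()) , (λ ()) , (λ ())
transversal {P = P} {_∼_} P? _∼?_ ∼-refl ∼-sym (suc n) e
  with transversal P? _∼?_ ∼-refl ∼-sym n (tail e)
... | m , u , Pu , covers , distinct with P? (head e) | Fin.any? (λ j → u j ∼? head e)
...   | no ¬P | _     = m , u , Pu ,
  (λ { zero P → contradiction P ¬P ; (suc i) → covers i }) , distinct
...   | yes _ | yes c = m , u , Pu , (λ { zero _ → c ; (suc i) → covers i }) , distinct
...   | yes P | no ¬c = suc m , head e ∷ u ,
  (λ { zero → P ; (suc j) → Pu j }) ,
  (λ { zero _ → zero , ∼-refl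
     ; (suc i) Pe → let j , c = covers i Pe in suc j , c }) ,
  λ { zero    zero    _ → ≡.refl
    ; zero    (suc j) c → contradiction (j , ∼-sym c) ¬c
    ; (suc i) zero    c → contradiction (i , c) ¬c
    ; (suc i) (suc j) c → ≡.cong suc (distinct i j c) }

-- Blowups

∪-adj : ∀ {V V′ W : Set} {a a′ b} {G : LoopedGraph V a} {G′ : LoopedGraph V′ a′} →
        (iso : G ≅ G′) (K : LoopedGraph W b) → ∀ x y →
        LoopedGraph.Adj (G ∪ K) x y ⇔
        LoopedGraph.Adj (G′ ∪ K) (Sum.map₁ (_≅_.to iso) x) (Sum.map₁ (_≅_.to iso) y)
∪-adj {G = G} {G′} iso K x y = mk⇔ (Pointwise.map (Equivalence.to (adj⇔ _ _)) id) (back x y)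
  where
  open _≅_ iso
  back : ∀ x y → LoopedGraph.Adj (G′ ∪ K) (Sum.map₁ to x) (Sum.map₁ to y) →
         LoopedGraph.Adj (G ∪ K) x y
  back (inj₁ u) (inj₁ v) (inj₁ uv) = inj₁ (Equivalence.from (adj⇔ u v) uv)
  back (inj₂ _) (inj₂ _) (inj₂ uv) = inj₂ uv

module _ {V W : Set} {a b} {G : SimpleGraph V a} {H : LoopedGraph W b} where

  private
    module G = SimpleGraph G
    module H = LoopedGraph H

  -- Equal parts give `independent` and `clique`, different parts `joined` and `unjoined`. Where the
  -- equivalence needs distinct vertices, they are distinct because `G` is loopless or because their
  -- parts differ.
  blowup-by : (part : V → W) →
              (∀ {x y} → x ≢ y → G.Adj x y ⇔ H.Adj (part x) (part y)) → IsBlowup G H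
  blowup-by part adj = record
    { part        = part
    ; independent = λ { ¬loop ≡.refl y∈i xy →
        ¬loop (≡.subst (H.Adj _) y∈i (to (adj (irrefl xy)) xy)) }
    ; clique      = λ { loop ≡.refl y∈i x≢y →
        from (adj x≢y) (≡.subst (H.Adj _) (≡.sym y∈i) loop) }
    ; joined      = λ { i≢j ij ≡.refl ≡.refl → from (adj (i≢j ∘ ≡.cong part)) ij }
    ; unjoined    = λ { i≢j ¬ij ≡.refl ≡.refl xy → ¬ij (to (adj (irrefl xy)) xy) }
    }
    where
    open Equivalence
    irrefl : ∀ {x y} → G.Adj x y → x ≢ y
    irrefl xy ≡.refl = G.loopless _ xy

  -- Converse of `blowup-by`. Which clause applies depends on whether the parts agree, and two
  -- clauses only refute adjacency in `G`, so both decisions enter.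
  blowup-adj : (blowup : IsBlowup G H) → DecidableEquality W → Binary.Decidable H.Adj →
               ∀ {x y} → x ≢ y →
               G.Adj x y ⇔ H.Adj (IsBlowup.part blowup x) (IsBlowup.part blowup y)
  blowup-adj blowup _≟_ adj? {x} {y} x≢y = mk⇔ forth back
    where
    open IsBlowup blowup
    forth : G.Adj x y → H.Adj (part x) (part y)
    forth xy = decidable-stable (adj? _ _) λ ¬ij → refute ¬ij (part x ≟ part y)
      where
      refute : ¬ H.Adj (part x) (part y) → ¬ Dec (part x ≡ part y)
      refute ¬ij (yes i≡j) = independent (¬ij ∘ ≡.subst (H.Adj _) i≡j) ≡.refl (≡.sym i≡j) xy
      refute ¬ij (no  i≢j) = unjoined i≢j ¬ij ≡.refl ≡.refl xy
    back : H.Adj (part x) (part y) → G.Adj x y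
    back ij with part x ≟ part y
    ... | yes i≡j = clique (≡.subst (H.Adj _) (≡.sym i≡j) ij) ≡.refl (≡.sym i≡j) x≢y
    ... | no  i≢j = joined i≢j ij ≡.refl ≡.refl

-- Matrices, linear independence and bilinear forms over an arbitrary field

module _ {c ℓ} (F : Field c ℓ) where

  open Field F hiding (zero)
  open RingProperties ring
    using (+-identityˡ-unique; x∙y⁻¹≈ε⇒x≈y; +-inverseʳ-unique; -‿distribˡ-*; -‿distribʳ-*;
           -‿involutive; //-rightDividesˡ)
  open SemiringSum semiring
    using (sum; sum-cong-≋; sum-replicate-zero; ∑-comm; ∑-distrib-+;
           *-distribʳ-sum; *-distribˡ-sum)
  open SetoidReasoning setoid

  private
    infixl 7 _·_
    _·_ : ∀ {l m n} → Matrix F l m → Matrix F m n → Matrix F l n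
    _·_ = _⊗_ F

    infix 4 _≋_
    _≋_ : ∀ {m n} → Rel (Matrix F m n) ℓ
    _≋_ = _≈ᴹ_ F

    Independent : ∀ {m r} → Matrix F r m → Set (c ⊔ ℓ)
    Independent = LinearlyIndependent F

  sum-zero : ∀ {n} {t : Vector Carrier n} → (∀ i → t i ≈ 0#) → sum t ≈ 0#
  sum-zero {n} t≈0 = trans (sum-cong-≋ t≈0) (sum-replicate-zero n)

  ·-assoc : ∀ {k l m n} (A : Matrix F k l) (B : Matrix F l m) (C : Matrix F m n) →
            A · B · C ≋ A · (B · C)
  ·-assoc A B C i j = begin
    sum (λ b → sum (λ a → A i a * B a b) * C b j)
      ≈⟨ sum-cong-≋ (λ b → *-distribʳ-sum (C b j) (λ a → A i a * B a b)) ⟩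
    sum (λ b → sum (λ a → A i a * B a b * C b j))
      ≈⟨ ∑-comm (λ b a → A i a * B a b * C b j) ⟩
    sum (λ a → sum (λ b → A i a * B a b * C b j))
      ≈⟨ sum-cong-≋ (λ a → sum-cong-≋ (λ b → *-assoc (A i a) (B a b) (C b j))) ⟩
    sum (λ a → sum (λ b → A i a * (B a b * C b j)))
      ≈⟨ sum-cong-≋ (λ a → *-distribˡ-sum (A i a) (λ b → B a b * C b j)) ⟨
    sum (λ a → A i a * sum (λ b → B a b * C b j)) ∎

  ·-congˡ : ∀ {l m n} (A : Matrix F l m) {B C : Matrix F m n} → B ≋ C → A · B ≋ A · C
  ·-congˡ A B≋C i j = sum-cong-≋ λ a → *-congˡ (B≋C a j)

  ·-identityˡ : ∀ {m n} (A : Matrix F m n) → I F · A ≋ A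
  ·-identityˡ A zero j = begin
    1# * A zero j + sum (λ b → 0# * A (suc b) j)
      ≈⟨ +-cong (*-identityˡ _) (sum-zero λ b → zeroˡ (A (suc b) j)) ⟩
    A zero j + 0#  ≈⟨ +-identityʳ _ ⟩
    A zero j       ∎
  ·-identityˡ A (suc i) j = begin
    0# * A zero j + (I F · tail A) i j  ≈⟨ +-cong (zeroˡ _) (·-identityˡ (tail A) i j) ⟩
    0# + A (suc i) j                    ≈⟨ +-identityˡ _ ⟩
    A (suc i) j                         ∎

  ·-identityʳ : ∀ {m n} (A : Matrix F m n) → A · I F ≋ A
  ·-identityʳ A i zero = begin
    A i zero * 1# + sum (λ b → A i (suc b) * 0#)
      ≈⟨ +-cong (*-identityʳ _) (sum-zero λ b → zeroʳ (A i (suc b))) ⟩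
    A i zero + 0#  ≈⟨ +-identityʳ _ ⟩
    A i zero       ∎
  ·-identityʳ A i (suc j) = begin
    A i zero * 0# + ((λ i j → A i (suc j)) · I F) i j
      ≈⟨ +-cong (zeroʳ _) (·-identityʳ (λ i j → A i (suc j)) i j) ⟩
    0# + A i (suc j)  ≈⟨ +-identityˡ _ ⟩
    A i (suc j)       ∎

  independent-resp : ∀ {m r} {v w : Matrix F r m} → v ≋ w → Independent v → Independent w
  independent-resp v≋w indep s sw≈0 = indep s λ i →
    trans (sum-cong-≋ λ j → *-congˡ (v≋w j i)) (sw≈0 i)

  -- A linear relation among the rows of `w` survives multiplication by `P` and becomes one among
  -- the rows of `v`.
  independent-factor : ∀ {l m r} {v : Matrix F r m} (w : Matrix F r l) (P : Matrix F l m) →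
                       v ≋ w · P → Independent v → Independent w
  independent-factor {v = v} w P v≋wP indep s sw≈0 = indep s λ i → begin
    sum (λ j → s j * v j i)           ≈⟨ sum-cong-≋ (λ j → *-congˡ (v≋wP j i)) ⟩
    -- The coefficients `s` are read as a matrix with a single row.
    sum (λ j → s j * (w · P) j i)     ≈⟨ ·-assoc {k = 1} (λ _ → s) w P zero i ⟨
    sum (λ b → sum (λ j → s j * w j b) * P b i)
      ≈⟨ sum-zero (λ b → trans (*-congʳ (sw≈0 b)) (zeroˡ _)) ⟩
    0#                                ∎

  -- Independence is applied to the coefficients `s - t`: their combination, added to that of `t`,
  -- gives that of `s`, so it vanishes.
  independent-cancel : ∀ {m r} {v : Matrix F r m} → Independent v →
                       (s t : Vector Carrier r) →
                       (∀ i → sum (λ j → s j * v j i) ≈ sum (λ j → t j * v j i)) →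
                       ∀ j → s j ≈ t j
  independent-cancel {v = v} indep s t sv≈tv j = x∙y⁻¹≈ε⇒x≈y _ _ $
    indep (λ j → s j - t j) (λ i → +-identityˡ-unique _ _ (begin
      sum (λ j → (s j - t j) * v j i) + sum (λ j → t j * v j i)
        ≈⟨ ∑-distrib-+ (λ j → (s j - t j) * v j i) (λ j → t j * v j i) ⟨
      sum (λ j → (s j - t j) * v j i + t j * v j i)
        ≈⟨ sum-cong-≋ (λ j → trans (sym (distribʳ _ _ _)) (*-congʳ (//-rightDividesˡ (t j) (s j)))) ⟩
      sum (λ j → s j * v j i)  ≈⟨ sv≈tv i ⟩
      sum (λ j → t j * v j i)  ∎)) j

  -- The (x , y) entry of P · B · transpose Q is form B (P x) (Q y) by definition.

  form : ∀ {k l} → Matrix F k l → Vector Carrier k → Vector Carrier l → Carrier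
  form B v w = sum (λ b → sum (λ a → v a * B a b) * w b)

  form-zeroˡ : ∀ {k l} (B : Matrix F k l) {v} w → (∀ i → v i ≈ 0#) → form B v w ≈ 0#
  form-zeroˡ B w v≈0 = sum-zero λ b →
    trans (*-congʳ (sum-zero λ a → trans (*-congʳ (v≈0 a)) (zeroˡ (B a b)))) (zeroˡ (w b))

  form-zeroʳ : ∀ {k l} (B : Matrix F k l) v {w} → (∀ i → w i ≈ 0#) → form B v w ≈ 0#
  form-zeroʳ B v w≈0 = sum-zero λ b → trans (*-congˡ (w≈0 b)) (zeroʳ _)

  -- Rescaling both arguments by nonzero scalars therefore leaves the zero pattern unchanged, which
  -- is why class representatives suffice.
  form-scale : ∀ {k l} (B : Matrix F k l) {v v′ w w′ s t} →
               (∀ i → v′ i ≈ s * v i) → (∀ i → w′ i ≈ t * w i) →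
               form B v′ w′ ≈ s * t * form B v w
  form-scale B {v} {v′} {w} {w′} {s} {t} v′≈sv w′≈tw = begin
    sum (λ b → sum (λ a → v′ a * B a b) * w′ b)  ≈⟨ sum-cong-≋ summand ⟩
    sum (λ b → s * t * (sum (λ a → v a * B a b) * w b))
      ≈⟨ *-distribˡ-sum (s * t) (λ b → sum (λ a → v a * B a b) * w b) ⟨
    s * t * form B v w ∎
    where
    summand : ∀ b → sum (λ a → v′ a * B a b) * w′ b ≈ s * t * (sum (λ a → v a * B a b) * w b)
    summand b = begin
      sum (λ a → v′ a * B a b) * w′ b
        ≈⟨ *-cong (sum-cong-≋ (λ a → trans (*-congʳ (v′≈sv a)) (*-assoc _ _ _))) (w′≈tw b) ⟩
      sum (λ a → s * (v a * B a b)) * (t * w b)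
        ≈⟨ *-congʳ (*-distribˡ-sum s (λ a → v a * B a b)) ⟨
      s * sum (λ a → v a * B a b) * (t * w b)
        ≈⟨ interchange *-commutativeSemigroup _ _ _ _ ⟩
      s * t * (sum (λ a → v a * B a b) * w b) ∎

  ≉0-* : ∀ {x y} → x ≉ 0# → y ≉ 0# → x * y ≉ 0#
  ≉0-* {x} {y} x≉0 y≉0 xy≈0 with inverse x x≉0
  ... | z , xz≈1 = y≉0 $ begin
    y            ≈⟨ *-identityʳ y ⟨
    y * 1#       ≈⟨ *-congˡ xz≈1 ⟨
    y * (x * z)  ≈⟨ *-assoc _ _ _ ⟨
    y * x * z    ≈⟨ *-congʳ (trans (*-comm _ _) xy≈0) ⟩
    0# * z       ≈⟨ zeroˡ z ⟩
    0#           ∎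

  -- Proportional vectors and the graph of a form

  ∼-refl : ∀ {k} → Reflexive (_∼_ F {k})
  ∼-refl = 1# , 0≉1 ∘ sym , λ i → sym (*-identityˡ _)

  ∼-sym : ∀ {k} → Symmetric (_∼_ F {k})
  ∼-sym {x = x} {y} (t , t≉0 , y≈tx) with inverse t t≉0
  ... | z , tz≈1 =
    z , (λ z≈0 → 0≉1 (trans (sym (zeroʳ t)) (trans (*-congˡ (sym z≈0)) tz≈1))) , λ i → begin
      x i            ≈⟨ *-identityˡ _ ⟨
      1# * x i       ≈⟨ *-congʳ (trans (*-comm _ _) tz≈1) ⟨
      z * t * x i    ≈⟨ *-assoc _ _ _ ⟩
      z * (t * x i)  ≈⟨ *-congˡ (y≈tx i) ⟨
      z * y i        ∎

  module _ {k m} (U : Vector (Vector Carrier k) m)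
           (B : Matrix F k k) (B-sym : IsSymmetric F B) where

    -- inj₂ tt, the vertex of K₁, stands for the zero vector. The rows of U are the class
    -- representatives here, so U is the transpose of the paper's.

    Labels : Fin m ⊎ ⊤ → Vector Carrier k → Set (c ⊔ ℓ)
    Labels (inj₁ j) w = _∼_ F (U j) w
    Labels (inj₂ _) w = Level.Lift c (∀ i → w i ≈ 0#)

    -- Between two representatives the form changes by a nonzero factor `s * t`; a zero vector makes
    -- it vanish, matching the isolated vertex of `K₁`.
    labels-adj : ∀ {p p′ w w′} → Labels p w → Labels p′ w′ →
      form B w w′ ≉ 0# ⇔
      LoopedGraph.Adj
        (Γ F (U · B · transpose U) (congruence-symmetric F (transpose U) B-sym) ∪ K₁) p p′
    labels-adj {inj₁ i} {inj₁ j} {w} {w′} (s , s≉0 , w≈) (t , t≉0 , w′≈) = mk⇔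
      (λ nz → inj₁ λ z → nz (trans scaled (trans (*-congˡ z) (zeroʳ _))))
      (λ { (inj₁ nz) z → ≉0-* (≉0-* s≉0 t≉0) nz (trans (sym scaled) z) })
      where
      scaled : form B w w′ ≈ s * t * form B (U i) (U j)
      scaled = form-scale B w≈ w′≈
    labels-adj {inj₂ _} {p′} {w} {w′} (Level.lift w≈0) _ = mk⇔
      (λ nz → contradiction (form-zeroˡ B w′ w≈0) nz)
      λ { (inj₂ ()) }
    labels-adj {inj₁ _} {inj₂ _} {w} {w′} _ (Level.lift w′≈0) = mk⇔
      (λ nz → contradiction (form-zeroʳ B w w′≈0) nz)
      λ ()

  -- Padding a congruence factorisation

  -- The block sum of a 1 × 1 identity with `A`. It enlarges an invertible symmetric matrix while
  -- keeping the form on vectors with leading entry 0.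
  border : ∀ {m n} → Matrix F m n → Matrix F (suc m) (suc n)
  border A zero    zero    = 1#
  border A zero    (suc j) = 0#
  border A (suc i) zero    = 0#
  border A (suc i) (suc j) = A i j

  border-· : ∀ {l m n} (A : Matrix F l m) (B : Matrix F m n) →
             border A · border B ≋ border (A · B)
  border-· A B zero    zero    =
    trans (+-cong (*-identityʳ 1#) (sum-zero λ b → zeroˡ (border B (suc b) zero))) (+-identityʳ 1#)
  border-· A B zero    (suc j) =
    trans (+-cong (zeroʳ 1#) (sum-zero λ b → zeroˡ (B b j))) (+-identityʳ 0#)
  border-· A B (suc i) zero    =
    trans (+-cong (zeroˡ 1#) (sum-zero λ b → zeroʳ (A i b))) (+-identityʳ 0#)
  border-· A B (suc i) (suc j) = trans (+-congʳ (zeroˡ 0#)) (+-identityˡ _)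

  border-I : ∀ {n} {A : Matrix F n n} → A ≋ I F → border A ≋ I F
  border-I A≋I zero    zero    = refl
  border-I A≋I zero    (suc j) = refl
  border-I A≋I (suc i) zero    = refl
  border-I A≋I (suc i) (suc j) = A≋I i j

  border-symmetric : ∀ {n} {A : Matrix F n n} → IsSymmetric F A → IsSymmetric F (border A)
  border-symmetric A-sym zero    zero    = refl
  border-symmetric A-sym zero    (suc j) = refl
  border-symmetric A-sym (suc i) zero    = refl
  border-symmetric A-sym (suc i) (suc j) = A-sym i j

  border-invertible : ∀ {n} {A : Matrix F n n} → IsInvertible F A → IsInvertible F (border A)
  border-invertible {A = A} (C , AC≋I , CA≋I) = border C ,
    (λ i j → trans (border-· A C i j) (border-I AC≋I i j)) ,
    (λ i j → trans (border-· C A i j) (border-I CA≋I i j))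

  form-border : ∀ {k l} (B : Matrix F k l) v w → form (border B) (0# ∷ v) (0# ∷ w) ≈ form B v w
  form-border B v w = begin
    sum (λ a → (0# ∷ v) a * border B a zero) * 0# +
      sum (λ b → (0# * 0# + sum (λ a → v a * B a b)) * w b)
      ≈⟨ +-cong (zeroʳ _)
           (sum-cong-≋ λ b → *-congʳ {w b}
             (trans (+-congʳ (zeroˡ 0#)) (+-identityˡ (sum λ a → v a * B a b)))) ⟩
    0# + form B v w  ≈⟨ +-identityˡ _ ⟩
    form B v w       ∎

  -- The row `rows x` is the vector attached to the vertex `x`; entries of `A` are the values of the
  -- form `B` on these vectors.
  record CongruenceFactorisation {n} (k : ℕ) (A : Matrix F n n) : Set (c ⊔ ℓ) where
    field
      B          : Matrix F k k
      symmetric  : IsSymmetric F B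
      invertible : IsInvertible F B
      rows       : Matrix F n k
      factor     : A ≋ rows · B · transpose rows

  -- Each step of `≤′` raises the size by one, which is one bordering.
  pad : ∀ {n k l} {A : Matrix F n n} → k ℕ.≤′ l →
        CongruenceFactorisation k A → CongruenceFactorisation l A
  pad ℕ.≤′-refl       fac = fac
  pad (ℕ.≤′-step k≤l) fac = record
    { B          = border B
    ; symmetric  = border-symmetric symmetric
    ; invertible = border-invertible invertible
    ; rows       = λ x → 0# ∷ rows x
    ; factor     = λ x y → trans (factor x y) (sym (form-border B (rows x) (rows y)))
    }
    where open CongruenceFactorisation (pad k≤l fac)

  -- Linear algebra over a finite field

  module _ {q} (order : HasOrder F q) where

    private
      module order = Inverse order
      open Injection (Inverse⇒Injection order) using () renaming (injective to to-injective)

      from-injective : ∀ {i j} → order.from i ≈ order.from j → i ≡ j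
      from-injective {i} {j} eq = ≡.trans (≡.sym (order.strictlyInverseˡ i))
        (≡.trans (order.to-cong eq) (order.strictlyInverseˡ j))

    infix 4 _≈?_ _∼?_

    _≈?_ : Binary.Decidable _≈_
    _≈?_ = via-injection (Inverse⇒Injection order) Fin._≟_

    enumerable : Enumerable setoid
    enumerable = q , order.from , λ x → order.to x , order.strictlyInverseʳ x

    vectorSetoid : ℕ → Setoid c ℓ
    vectorSetoid = VectorEquality.≋-setoid setoid

    enumerableᵛ : ∀ n → Enumerable (vectorSetoid n)
    enumerableᵛ = enumerable-vectors setoid enumerable

    enumerableᴹ : ∀ m n → Enumerable (VectorEquality.≋-setoid (vectorSetoid n) m)
    enumerableᴹ m n = enumerable-vectors (vectorSetoid n) (enumerableᵛ n) m

    1<q : 1 < q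
    1<q = distinct⇒1< (order.to 0#) (order.to 1#)
      λ eq → 0≉1 (to-injective eq)
      where
      distinct⇒1< : ∀ {n} (i j : Fin n) → i ≢ j → 1 < n
      distinct⇒1< {1}           zero zero i≢j = contradiction ≡.refl i≢j
      distinct⇒1< {suc (suc n)} _    _    _   = s≤s (s≤s z≤n)

    -- The map s ↦ Σⱼ sⱼ vⱼ embeds Fʳ into Fᵐ, so q ^ r ≤ q ^ m.
    independent⇒≤ : ∀ {m r} (v : Matrix F r m) → Independent v → r ≤ m
    independent⇒≤ {m} {r} v indep = ℕ.≮⇒≥ λ m<r →
      ℕ.<⇒≱ (ℕ.^-monoʳ-< q 1<q m<r) (Fin.injective⇒≤ encode-injective)
      where
      coefficients : Fin (q ^ r) → Vector Carrier r
      coefficients x j = order.from (finToFun x j)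
      combination : Fin (q ^ r) → Vector Carrier m
      combination x i = sum (λ j → coefficients x j * v j i)
      encode : Fin (q ^ r) → Fin (q ^ m)
      encode x = funToFin (λ i → order.to (combination x i))
      encode-injective : ∀ {x y} → encode x ≡ encode y → x ≡ y
      encode-injective {x} {y} eq = finToFun-injective λ j →
        from-injective
          (independent-cancel indep (coefficients x) (coefficients y)
             (λ i → to-injective (funToFin-injective eq i)) j)

    -- Finite search makes the conclusion decidable, so it may be proved by contradiction. In a
    -- relation among all rows, a nonzero leading coefficient lets the head be solved for; a zero
    -- one leaves a relation on the independent tail.
    dependent⇒span : ∀ {m r} (v : Matrix F (suc r) m) → Independent (tail v) → ¬ Independent v →
                     ∃[ s ] ∀ i → head v i ≈ sum (λ j → s j * v (suc j) i)
    dependent⇒span {m} {r} v tail-indep dep = decidable-stable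
      (exists? (vectorSetoid r) (enumerableᵛ r)
        (λ s≋t sv i → trans (sv i) (sum-cong-≋ λ j → *-congʳ (s≋t j)))
        (λ s → Fin.all? λ i → head v i ≈? sum (λ j → s j * v (suc j) i)))
      λ ¬span → dep λ s sv≈0 → independent ¬span s sv≈0 (s zero ≈? 0#)
      where
      independent : ¬ (∃[ s ] ∀ i → head v i ≈ sum (λ j → s j * v (suc j) i)) →
                    ∀ s → (∀ i → sum (λ j → s j * v j i) ≈ 0#) → Dec (s zero ≈ 0#) →
                    ∀ j → s j ≈ 0#
      independent _ s sv≈0 (yes s₀≈0) = λ
        { zero    → s₀≈0
        ; (suc j) → tail-indep (tail s) (λ i → begin
            sum (λ j → s (suc j) * v (suc j) i)       ≈⟨ +-identityˡ _ ⟨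
            0# + sum (λ j → s (suc j) * v (suc j) i)
              ≈⟨ +-congʳ (trans (*-congʳ s₀≈0) (zeroˡ (v zero i))) ⟨
            sum (λ j → s j * v j i)                   ≈⟨ sv≈0 i ⟩
            0#                                        ∎) j
        }
      independent ¬span s sv≈0 (no s₀≉0) with inverse (s zero) s₀≉0
      -- Dividing the relation by its leading coefficient and moving the tail across gives the
      -- coefficients.
      ... | y , s₀y≈1 = contradiction ((λ j → - y * s (suc j)) , solve) ¬span
        where
        solve : ∀ i → head v i ≈ sum (λ j → - y * s (suc j) * v (suc j) i)
        solve i = begin
          x                          ≈⟨ *-identityˡ x ⟨
          1# * x                     ≈⟨ *-congʳ (trans (*-comm y (s zero)) s₀y≈1) ⟨
          y * s zero * x             ≈⟨ *-assoc y (s zero) x ⟩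
          y * (s zero * x)           ≈⟨ -‿involutive _ ⟨
          - - (y * (s zero * x))     ≈⟨ -‿cong (-‿distribˡ-* y (s zero * x)) ⟩
          - (- y * (s zero * x))     ≈⟨ -‿distribʳ-* (- y) (s zero * x) ⟩
          - y * - (s zero * x)       ≈⟨ *-congˡ (+-inverseʳ-unique (s zero * x) _ (sv≈0 i)) ⟨
          - y * sum (λ j → s (suc j) * v (suc j) i)
            ≈⟨ *-distribˡ-sum (- y) (λ j → s (suc j) * v (suc j) i) ⟩
          sum (λ j → - y * (s (suc j) * v (suc j) i))
            ≈⟨ sum-cong-≋ (λ j → *-assoc (- y) (s (suc j)) (v (suc j) i)) ⟨
          sum (λ j → - y * s (suc j) * v (suc j) i) ∎
          where
          x : Carrier
          x = v zero i

    -- No r + 1 vectors of Fʳ are independent, so each unit vector lies in the row span of `C`; the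
    -- coefficients form a left inverse `Y`.
    independent⇒invertible : ∀ {r} (C : Matrix F r r) → Independent C → IsInvertible F C
    independent⇒invertible {r} C indep = Y , CY≋I , YC≋I
      where
      span : ∀ i → ∃[ s ] ∀ j → I F i j ≈ sum (λ a → s a * C a j)
      span i = dependent⇒span (I F i ∷ C) indep
        λ indep′ → ℕ.1+n≰n (independent⇒≤ (I F i ∷ C) indep′)
      Y : Matrix F r r
      Y i = proj₁ (span i)
      YC≋I : Y · C ≋ I F
      YC≋I i j = sym (proj₂ (span i) j)
      CY≋I : C · Y ≋ I F
      -- `C · Y` and the identity agree after multiplication by `C` on the right, and the rows of
      -- `C` are independent.
      CY≋I i = independent-cancel indep ((C · Y) i) (I F i) λ j → begin
        (C · Y · C) i j    ≈⟨ ·-assoc C Y C i j ⟩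
        (C · (Y · C)) i j  ≈⟨ ·-congˡ C YC≋I i j ⟩
        (C · I F) i j      ≈⟨ ·-identityʳ C i j ⟩
        C i j              ≈⟨ ·-identityˡ C i j ⟨
        (I F · C) i j      ∎

    -- If the columns f of A are a basis of its column space, A = AᶠXᵗ for some X, so
    -- by symmetry Aᶠ = XC with C the principal submatrix on f, and A = XCXᵗ. Independence
    -- of the columns of Aᶠ passes to those of C, which is therefore invertible.
    factorise : ∀ {n r} (A : Matrix F n n) → IsSymmetric F A → HasRank F A r →
                CongruenceFactorisation r A
    factorise {n} {r} A A-sym ((f , indep) , maximal) = record
      { B          = C
      ; symmetric  = C-sym
      ; invertible = independent⇒invertible C (independent-factor C (transpose X) columns indep)
      ; rows       = X
      ; factor     = factor
      }
      where
      C : Matrix F r r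
      C a b = A (f a) (f b)
      C-sym : IsSymmetric F C
      C-sym a b = A-sym (f a) (f b)
      span : ∀ y → ∃[ s ] ∀ i → A i y ≈ sum (λ a → s a * A i (f a))
      span y = dependent⇒span (λ a i → A i ((y ∷ f) a)) indep
        -- Prepending column `y` to a family of maximal length cannot keep it independent.
        λ indep′ → ℕ.1+n≰n (maximal (suc r) (y ∷ f , indep′))
      X : Matrix F n r
      X y = proj₁ (span y)
      A≈ : ∀ i y → A i y ≈ sum (λ a → X y a * A i (f a))
      A≈ i y = proj₂ (span y) i
      columns : transpose A ∘ f ≋ C · transpose X
      columns b i = begin
        A i (f b)                          ≈⟨ A-sym (f b) i ⟩
        A (f b) i                          ≈⟨ A≈ (f b) i ⟩
        sum (λ a → X i a * A (f b) (f a))  ≈⟨ sum-cong-≋ (λ a → *-comm (X i a) (A (f b) (f a))) ⟩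
        (C · transpose X) b i              ∎
      factor : A ≋ X · C · transpose X
      factor x y = begin
        A x y                              ≈⟨ A≈ x y ⟩
        sum (λ a → X y a * A x (f a))      ≈⟨ sum-cong-≋ (λ a → *-congˡ (columns a x)) ⟩
        sum (λ a → X y a * (C · transpose X) a x)
          ≈⟨ ·-assoc X C (transpose X) y x ⟨
        -- The chain has reached the transposed entry; symmetry of the product turns it back.
        (X · C · transpose X) y x          ≈⟨ congruence-symmetric F (transpose X) C-sym x y ⟩
        (X · C · transpose X) x y          ∎

    -- Minimum rank over a finite field

    independent? : ∀ {m r} → Decidable (Independent {m} {r})
    independent? {r = r} v = forall? (vectorSetoid r) (enumerableᵛ r)
      (λ s≋t indep tv≈0 j → trans (sym (s≋t j))
        (indep (λ i → trans (sum-cong-≋ λ j → *-congʳ (s≋t j)) (tv≈0 i)) j))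
      λ s → Fin.all? (λ i → sum (λ j → s j * v j i) ≈? 0#) →-dec Fin.all? λ j → s j ≈? 0#

    independentColumns? : ∀ {m n} (A : Matrix F m n) → Decidable (IndependentColumns F A)
    independentColumns? {n = n} A r =
      exists? (VectorEquality.≋-setoid (≡.setoid (Fin n)) r)
        (enumerable-vectors (≡.setoid (Fin n)) (enumerable-Fin n) r)
        (λ f≗g → independent-resp λ j i → reflexive (≡.cong (A i) (f≗g j)))
        λ f → independent? (transpose A ∘ f)

    rank : ∀ {m n} (A : Matrix F m n) → ∃[ r ] HasRank F A r
    -- The empty family starts the search, and the number of rows bounds it, since the columns lie
    -- in Fᵐ.
    rank {m} A = greatest (independentColumns? A) ((λ ()) , λ _ _ ()) m
      λ r (f , indep) → independent⇒≤ (transpose A ∘ f) indep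

    hasRank? : ∀ {m n} (A : Matrix F m n) → Decidable (HasRank F A)
    hasRank? A r with rank A
    ... | s , As , s-max = map′ (λ { ≡.refl → As , s-max })
      (λ (Ar , r-max) → ℕ.≤-antisym (r-max s As) (s-max r Ar)) (s ℕ.≟ r)

    hasRank-resp : ∀ {m n r} {A B : Matrix F m n} → A ≋ B → HasRank F A r → HasRank F B r
    hasRank-resp A≋B ((f , indep) , maximal) =
      (f , independent-resp (λ j i → A≋B i (f j)) indep) ,
      λ s (g , indep′) → maximal s (g , independent-resp (λ j i → sym (A≋B i (g j))) indep′)

    module _ {n g} (G : SimpleGraph (Fin n) g) where

      open SimpleGraph G

      S-resp : ∀ {A B} → A ≋ B → S F G A → S F G B
      S-resp A≋B (A-sym , A-adj) =
        (λ i j → trans (sym (A≋B j i)) (trans (A-sym i j) (A≋B i j))) ,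
        λ i j i≢j → mk⇔
          (λ B≉0 → Equivalence.to (A-adj i j i≢j) (B≉0 ∘ trans (sym (A≋B i j))))
          (λ ij → Equivalence.from (A-adj i j i≢j) ij ∘ trans (A≋B i j))

      S? : Binary.Decidable Adj → Decidable (S F G)
      S? adj? A = (Fin.all? λ i → Fin.all? λ j → A j i ≈? A i j) ×-dec
        Fin.all? λ i → Fin.all? λ j → ¬? (i Fin.≟ j) →-dec
          map′ (λ (f , g) → mk⇔ f g) (λ e → Equivalence.to e , Equivalence.from e)
            ((¬? (A i j ≈? 0#) →-dec adj? i j) ×-dec (adj? i j →-dec ¬? (A i j ≈? 0#)))

      -- One matrix of rank at most `k` suffices: the minimum rank exists by search over the
      -- finitely many matrices, and it cannot exceed `r`.
      𝒢-intro : ∀ {A r k} → S F G A → HasRank F A r → r ≤ k → 𝒢 F k G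
      𝒢-intro {A} {r} {k} SA hr r≤k =
        let m , m≤r , attained , minimal = least attains? r (A , SA , hr)
        in m , (attained , λ A SA s hs → minimal s (A , SA , hs)) , ℕ.≤-trans m≤r r≤k
        where
        -- Adjacency is read off the zero pattern of the given `A` away from the diagonal, and from
        -- looplessness on it.
        adj? : Binary.Decidable Adj
        adj? i j with i Fin.≟ j
        ... | yes ≡.refl = no (loopless i)
        ... | no  i≢j    = Dec.map (proj₂ SA i j i≢j) (¬? (A i j ≈? 0#))
        attains? : Decidable (λ r → ∃[ A ] S F G A × HasRank F A r)
        attains? r = exists? (VectorEquality.≋-setoid (vectorSetoid n) n) (enumerableᴹ n n)
          (λ A≋B (SA , hr) → S-resp A≋B SA , hasRank-resp A≋B hr)
          λ A → S? adj? A ×-dec hasRank? A r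

    -- Representatives of the classes of proportional vectors

    nonzero? : ∀ {k} → Decidable (IsNonzero F {k})
    nonzero? x = ¬? (Fin.all? λ i → x i ≈? 0#)

    _∼?_ : ∀ {k} → Binary.Decidable (_∼_ F {k})
    x ∼? y = exists? setoid enumerable
      (λ s≈t (s≉0 , y≈sx) → s≉0 ∘ trans s≈t , λ i → trans (y≈sx i) (*-congʳ s≈t))
      λ t → ¬? (t ≈? 0#) ×-dec Fin.all? λ i → y i ≈? t * x i

    representatives : ∀ k → ∃[ m ] Σ[ U ∈ Matrix F k m ] IsRepresentatives F U
    representatives k with enumerableᵛ k
    ... | N , e , covers with transversal nonzero? _∼?_ ∼-refl ∼-sym N e
    ...   | m , u , nz , complete , distinct = m , transpose u , record
      { nonzero  = nz
      ; complete = λ x x≢0 →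
          let i , e≋x        = covers x
              -- The transversal covers only the listed vectors, so `x` is first replaced by its
              -- listed copy `e i`.
              j , t , t≉0 , e≈ = complete i λ e≈0 → x≢0 λ l → trans (sym (e≋x l)) (e≈0 l)
          in j , t , t≉0 , λ l → trans (sym (e≋x l)) (e≈ l)
      ; distinct = distinct
      }

    ≉0-cong : ∀ {x y} → x ≈ y → x ≉ 0# ⇔ y ≉ 0#
    ≉0-cong x≈y = mk⇔ (_∘ trans x≈y) (_∘ trans (sym x≈y))

    -- From low minimum rank to blowups and back

    module _ {k : ℕ} {n g} (G : SimpleGraph (Fin n) g) where

      private
        module G = SimpleGraph G

      𝒢⇒blowup : 𝒢 F k G → ∃[ m ] Σ[ H ∈ LoopedGraph (Fin m) ℓ ] 𝔤 F k H × IsBlowup G (H ∪ K₁)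
      𝒢⇒blowup (r , ((A , (A-sym , A-adj) , hr) , _) , r≤k) = m , Γᵁ , record
        { U               = U
        ; representatives = reps
        ; B               = B
        ; symmetric       = symmetric
        ; invertible      = invertible
        -- `H` is chosen to be `Γᵁ` itself, so the identity serves.
        ; isomorphism     = record { bijection = ↔-id _ ; adj⇔ = λ _ _ → ⇔-id _ }
        } , blowup-by (proj₁ ∘ label) adj
        where
        open CongruenceFactorisation (pad (ℕ.≤⇒≤′ r≤k) (factorise A A-sym hr))
        m : ℕ
        m = proj₁ (representatives k)
        U : Matrix F k m
        U = proj₁ (proj₂ (representatives k))
        reps : IsRepresentatives F U
        reps = proj₂ (proj₂ (representatives k))
        Γᵁ : LoopedGraph (Fin m) ℓ
        Γᵁ = Γ F (transpose U · B · U) (congruence-symmetric F U symmetric)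
        label : ∀ x → ∃[ p ] Labels (transpose U) B symmetric p (rows x)
        label x with nonzero? (rows x)
        ... | yes w≢0 = let j , u∼w = IsRepresentatives.complete reps (rows x) w≢0 in inj₁ j , u∼w
        ... | no  w≡0 = inj₂ tt , Level.lift (decidable-stable (Fin.all? λ i → rows x i ≈? 0#) w≡0)
        adj : ∀ {x y} → x ≢ y →
              G.Adj x y ⇔ LoopedGraph.Adj (Γᵁ ∪ K₁) (proj₁ (label x)) (proj₁ (label y))
        adj {x} {y} x≢y =
          labels-adj (transpose U) B symmetric (proj₂ (label x)) (proj₂ (label y)) ⇔-∘
          (≉0-cong (factor x y) ⇔-∘ ⇔-sym (A-adj x y x≢y))

      blowup⇒𝒢 : ∀ {m} {H : LoopedGraph (Fin m) ℓ} → 𝔤 F k H → IsBlowup G (H ∪ K₁) → 𝒢 F k G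
      blowup⇒𝒢 {m} {H} H∈𝔤 blowup = 𝒢-intro G (A-sym , A-adj) (proj₂ (rank A)) rank≤k
        where
        module H = LoopedGraph H
        open 𝔤 H∈𝔤 hiding (m)
        open _≅_ isomorphism
        open IsBlowup blowup
        Γᵁ : LoopedGraph (Fin (𝔤.m H∈𝔤)) ℓ
        Γᵁ = Γ F (transpose U · B · U) (congruence-symmetric F U symmetric)
        vector : Fin (𝔤.m H∈𝔤) ⊎ ⊤ → Vector Carrier k
        vector (inj₁ j) = transpose U j
        vector (inj₂ _) = λ _ → 0#
        vector-label : ∀ p → Labels (transpose U) B symmetric p (vector p)
        vector-label (inj₁ j) = ∼-refl
        vector-label (inj₂ _) = Level.lift λ _ → refl
        X : Matrix F n k
        -- `H` is only isomorphic to `Γᵁ`, so the part of `x` is carried over by `to` before its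
        -- vector is looked up.
        X x = vector (Sum.map₁ to (part x))
        A : Matrix F n n
        A = X · B · transpose X
        A-sym : IsSymmetric F A
        A-sym = congruence-symmetric F (transpose X) symmetric
        H-adj? : Binary.Decidable H.Adj
        H-adj? i j = Dec.map (⇔-sym (adj⇔ i j)) (¬? (_ ≈? 0#))
        A-adj : ∀ x y → x ≢ y → A x y ≉ 0# ⇔ G.Adj x y
        A-adj x y x≢y =
          ⇔-sym (blowup-adj blowup (Sum.≡-dec Fin._≟_ Unit._≟_)
                   (Pointwise.⊎-decidable H-adj? λ _ _ → no λ ()) x≢y) ⇔-∘
          (⇔-sym (∪-adj isomorphism K₁ (part x) (part y)) ⇔-∘
           labels-adj (transpose U) B symmetric (vector-label _) (vector-label _))
        rank≤k : proj₁ (rank A) ≤ k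
        rank≤k = let f , indep = proj₁ (proj₂ (rank A)) in
          -- The chosen columns of `A` are the rows of `X ∘ f` times the transpose of `X · B`, so
          -- their independence passes to vectors of length `k`.
          independent⇒≤ (X ∘ f) (independent-factor (X ∘ f) (transpose (X · B))
            (λ j i → sum-cong-≋ λ b → *-comm ((X · B) i b) (X (f j) b)) indep)

mainTheorem1 : ∀ {c ℓ g} (q : ℕ) → IsPrimePower q →
    (F : Field c ℓ) → HasOrder F q →
    (k : ℕ) → 1 ≤ k →
    (n : ℕ) (G : SimpleGraph (Fin n) g) →
    𝒢 F k G ⇔
    (∃[ m ] Σ[ H ∈ LoopedGraph (Fin m) ℓ ] 𝔤 F k H × IsBlowup G (H ∪ K₁))
mainTheorem1 q _ F order k _ n G = mk⇔ (𝒢⇒blowup F order G)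
  λ (m , H , H∈𝔤 , blowup) → blowup⇒𝒢 F order G H∈𝔤 blowup
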